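{- Let $\mathbb F$ be an algebraically closed field and $V$ a vector space over $\mathbb F$ of dimension $d+1$ with $d\ge3$. Let $\Phi=(A;\{E_i\}_{i=0}^d;A^*;\{E^*_i\}_{i=0}^d)$ be a Leonard system on $V$, and let $a_0=\mathrm{tr}(E^*_0A)$. Assume that $\dim{\mathcal Z}(\Phi)=2$. Then the elements $A-a_0I$ and $AA^*-a_0A^*$ form a basis for ${\mathcal Z}(\Phi)$.
   Context: A tridiagonal matrix is irreducible if all entries on its subdiagonal and superdiagonal are nonzero. A Leonard pair on $V$ is an ordered pair $A,A^*\in \mathrm{End}(V)$ such that (i) there is a basis of $V$ with respect to which $A$ is irreducible tridiagonal and $A^*$ is diagonal; (ii) there is a basis of $V$ with respect to which $A^*$ is irreducible tridiagonal and $A$ is diagonal. Then $A,A^*$ are multiplicity-free (diagonalizable with one-dimensional eigenspaces). The primitive idempotent of $A$ for an eigenvalue $\theta$ is the projection onto the $\theta$-eigenspace along the sum of the other eigenspaces. An ordering of the eigenvalues of $A$ (and the corresponding ordering $\{E_i\}_{i=0}^d$ of primitive idempotents) is standard if corresponding eigenvectors $v_0,\dots,v_d$, in this order, form a basis as in (ii). Standard orderings for $A^*$ are defined similarly using (i). A Leonard system on $V$ is a sequence $\Phi=(A;\{E_i\}_{i=0}^d;A^*;\{E^*_i\}_{i=0}^d)$ where $A,A^*$ is a Leonard pair on $V$ and $\{E_i\}$, $\{E^*_i\}$ are standard orderings of the primitive idempotents of $A$, $A^*$. Zero diagonal space: ${\mathcal Z}(\Phi)$ is the set of $X\in\mathrm{Span}\{I,A^*,A,AA^*\}$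 such that $E^*_iXE^*_i=0$ for $0\le i\le d$; it is a subspace. Known fact: $I,A^*,A,AA^*,A^*A$ are linearly independent. -}

module Defs where

open import Algebra.Bundles using (CommutativeRing)
open import Algebra.Module.Bundles using (LeftModule)
open import Algebra.Module.Morphism.Structures using (module LeftModuleMorphisms)
import Algebra.Module.Morphism.Construct.Composition as Compose
import Algebra.Module.Morphism.Construct.Identity as Identity
import Algebra.Properties.AbelianGroup as AbelianGroupProperties
import Algebra.Properties.CommutativeMonoid.Sum as Sum
import Algebra.Properties.CommutativeSemigroup as CommutativeSemigroupProperties
import Algebra.Properties.Semiring.Exp as Exp
open import Data.Fin.Base using (Fin; toℕ; fromℕ)
open import Data.Nat.Base using (ℕ; suc; _<_; ∣_-_∣)
open import Data.Product.Base using (∃; Σ; _×_; _,_; proj₁)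
open import Data.Unit.Base using (tt)
open import Data.Vec.Functional using (Vector; []; _∷_)
open import Level using (Level; _⊔_) renaming (suc to lsuc)
open import Relation.Binary.PropositionalEquality.Core using (_≡_; _≢_)
open import Relation.Nullary.Negation.Core using (¬_)
open import Relation.Unary using (Pred; U)

-- Equality need not be decidable, so discrete fields are a special case.
record Field (c ℓ : Level) : Set (lsuc (c ⊔ ℓ)) where
  field
    commutativeRing : CommutativeRing c ℓ
  open CommutativeRing commutativeRing public
  field
    1≉0     : ¬ (1# ≈ 0#)
    inverse : ∀ x → ¬ (x ≈ 0#) → ∃ λ y → x * y ≈ 1#

module _ {c ℓ : Level} (F : Field c ℓ) where
  open Field F
  open Exp semiring using (_^_)
  open Sum +-commutativeMonoid using (sum)

  -- The polynomial with coefficients a, the constant term first.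
  evalPoly : ∀ {n} → Vector Carrier n → Carrier → Carrier
  evalPoly a x = sum λ i → a i * x ^ toℕ i

  AlgebraicallyClosed : Set (c ⊔ ℓ)
  AlgebraicallyClosed =
    ∀ n (a : Vector Carrier (suc (suc n))) →
    ¬ (a (fromℕ (suc n)) ≈ 0#) → ∃ λ x → evalPoly a x ≈ 0#

VectorSpace : {c ℓ : Level} (F : Field c ℓ) (m ℓm : Level) →
              Set (c ⊔ ℓ ⊔ lsuc (m ⊔ ℓm))
VectorSpace F m ℓm = LeftModule (Field.ring F) m ℓm

module _ {c ℓ m ℓm : Level} (F : Field c ℓ) (V : VectorSpace F m ℓm) where
  open Field F using (Carrier; _≈_; 0#)
  open LeftModule V
  open Sum +ᴹ-commutativeMonoid using (sum)

  linComb : ∀ {n} → Vector Carrier n → Vector Carrierᴹ n → Carrierᴹ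
  linComb a v = sum λ i → a i *ₗ v i

  Span : ∀ {n} → Vector Carrierᴹ n → Pred Carrierᴹ (c ⊔ ℓm)
  Span v x = ∃ λ a → x ≈ᴹ linComb a v

  LinearlyIndependent : ∀ {n} → Vector Carrierᴹ n → Set (c ⊔ ℓ ⊔ ℓm)
  LinearlyIndependent v = ∀ a → linComb a v ≈ᴹ 0ᴹ → ∀ i → a i ≈ 0#

  -- W is the underlying set of a subspace of V.
  record IsBasisOf {p : Level} (W : Pred Carrierᴹ p) {n : ℕ}
                   (v : Vector Carrierᴹ n) : Set (c ⊔ ℓ ⊔ m ⊔ ℓm ⊔ p) where
    field
      belongs     : ∀ i → W (v i)
      independent : LinearlyIndependent v
      spans       : ∀ x → W x → Span v x

  HasDimension : {p : Level} → Pred Carrierᴹ p → ℕ → Set (c ⊔ ℓ ⊔ m ⊔ ℓm ⊔ p)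
  HasDimension W n = Σ (Vector Carrierᴹ n) (IsBasisOf W)

  Basis : ℕ → Set (c ⊔ ℓ ⊔ m ⊔ ℓm)
  Basis n = HasDimension U n

  coord : ∀ {n} → Basis n → Carrierᴹ → Vector Carrier n
  coord (_ , isBasis) x = proj₁ (IsBasisOf.spans isBasis x tt)

module _ {c ℓ m ℓm : Level} (F : Field c ℓ) (V : VectorSpace F m ℓm) where
  open LeftModule V
  open LeftModuleMorphisms rawLeftModule rawLeftModule

  record End : Set (c ⊔ m ⊔ ℓm) where
    field
      ⟦_⟧      : Carrierᴹ → Carrierᴹ
      isLinear : IsLeftModuleHomomorphism ⟦_⟧
    open IsLeftModuleHomomorphism isLinear public

module _ {c ℓ m ℓm : Level} {F : Field c ℓ} {V : VectorSpace F m ℓm} where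
  open Field F using (*-comm; +-commutativeMonoid)
    renaming (Carrier to 𝔽; _≈_ to _≈𝔽_; 0# to 0𝔽; refl to reflF)
  open LeftModule V
  open LeftModuleMorphisms rawLeftModule rawLeftModule
  open End using (⟦_⟧)

  private
    linear : (f : Carrierᴹ → Carrierᴹ) →
             (∀ {x y} → x ≈ᴹ y → f x ≈ᴹ f y) →
             (∀ x y → f (x +ᴹ y) ≈ᴹ f x +ᴹ f y) →
             f 0ᴹ ≈ᴹ 0ᴹ →
             (∀ x → f (-ᴹ x) ≈ᴹ -ᴹ f x) →
             (∀ r x → f (r *ₗ x) ≈ᴹ r *ₗ f x) →
             End F V
    linear f f-cong f-+ f-0 f-neg f-* = record
      { ⟦_⟧ = f
      ; isLinear = record
        { +ᴹ-isGroupHomomorphism = record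
          { isMonoidHomomorphism = record
            { isMagmaHomomorphism = record
              { isRelHomomorphism = record { cong = f-cong }
              ; homo = f-+ }
            ; ε-homo = f-0 }
          ; ⁻¹-homo = f-neg }
        ; *ₗ-homo = f-* } }

    interchange : ∀ w x y z →
                  (w +ᴹ x) +ᴹ (y +ᴹ z) ≈ᴹ (w +ᴹ y) +ᴹ (x +ᴹ z)
    interchange = CommutativeSemigroupProperties.interchange
      (record { isCommutativeSemigroup =
        record { isSemigroup = +ᴹ-isSemigroup ; comm = +ᴹ-comm } })

    open AbelianGroupProperties +ᴹ-abelianGroup
      using (ε⁻¹≈ε; ⁻¹-∙-comm; inverseʳ-unique)

    *ₗ-neg : ∀ r x → r *ₗ (-ᴹ x) ≈ᴹ -ᴹ (r *ₗ x)
    *ₗ-neg r x = inverseʳ-unique (r *ₗ x) (r *ₗ (-ᴹ x))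
      (≈ᴹ-trans (≈ᴹ-sym (*ₗ-distribˡ r x (-ᴹ x)))
        (≈ᴹ-trans (*ₗ-cong reflF (-ᴹ‿inverseʳ x)) (*ₗ-zeroʳ r)))

    *ₗ-swap : ∀ r s x → r *ₗ (s *ₗ x) ≈ᴹ s *ₗ (r *ₗ x)
    *ₗ-swap r s x = ≈ᴹ-trans (≈ᴹ-sym (*ₗ-assoc r s x))
      (≈ᴹ-trans (*ₗ-cong (*-comm r s) ≈ᴹ-refl) (*ₗ-assoc s r x))

  infix  4 _≈ₑ_
  infixl 6 _+ₑ_ _-ₑ_
  infixr 7 _·ₑ_
  infixr 8 _∘ₑ_

  _≈ₑ_ : End F V → End F V → Set (m ⊔ ℓm)
  f ≈ₑ g = ∀ x → ⟦ f ⟧ x ≈ᴹ ⟦ g ⟧ x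

  idₑ : End F V
  idₑ = record
    { ⟦_⟧ = λ x → x
    ; isLinear = Identity.isLeftModuleHomomorphism rawLeftModule ≈ᴹ-refl }

  _∘ₑ_ : End F V → End F V → End F V
  f ∘ₑ g = record
    { ⟦_⟧ = λ x → ⟦ f ⟧ (⟦ g ⟧ x)
    ; isLinear = Compose.isLeftModuleHomomorphism ≈ᴹ-trans
                   (End.isLinear g) (End.isLinear f) }

  0ₑ : End F V
  0ₑ = linear (λ _ → 0ᴹ) (λ _ → ≈ᴹ-refl)
    (λ _ _ → ≈ᴹ-sym (+ᴹ-identityˡ 0ᴹ)) ≈ᴹ-refl
    (λ _ → ≈ᴹ-sym ε⁻¹≈ε) (λ r _ → ≈ᴹ-sym (*ₗ-zeroʳ r))

  _+ₑ_ : End F V → End F V → End F V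
  f +ₑ g = linear (λ x → ⟦ f ⟧ x +ᴹ ⟦ g ⟧ x)
    (λ e → +ᴹ-cong (f.⟦⟧-cong e) (g.⟦⟧-cong e))
    (λ x y → ≈ᴹ-trans (+ᴹ-cong (f.+ᴹ-homo x y) (g.+ᴹ-homo x y))
      (interchange (⟦ f ⟧ x) (⟦ f ⟧ y) (⟦ g ⟧ x) (⟦ g ⟧ y)))
    (≈ᴹ-trans (+ᴹ-cong f.0ᴹ-homo g.0ᴹ-homo) (+ᴹ-identityˡ 0ᴹ))
    (λ x → ≈ᴹ-trans (+ᴹ-cong (f.-ᴹ-homo x) (g.-ᴹ-homo x))
      (⁻¹-∙-comm (⟦ f ⟧ x) (⟦ g ⟧ x)))
    (λ r x → ≈ᴹ-trans (+ᴹ-cong (f.*ₗ-homo r x) (g.*ₗ-homo r x))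
      (≈ᴹ-sym (*ₗ-distribˡ r (⟦ f ⟧ x) (⟦ g ⟧ x))))
    where
    module f = End f
    module g = End g

  -ₑ_ : End F V → End F V
  -ₑ f = linear (λ x → -ᴹ ⟦ f ⟧ x)
    (λ e → -ᴹ‿cong (f.⟦⟧-cong e))
    (λ x y → ≈ᴹ-trans (-ᴹ‿cong (f.+ᴹ-homo x y))
      (≈ᴹ-sym (⁻¹-∙-comm (⟦ f ⟧ x) (⟦ f ⟧ y))))
    (≈ᴹ-trans (-ᴹ‿cong f.0ᴹ-homo) ε⁻¹≈ε)
    (λ x → -ᴹ‿cong (f.-ᴹ-homo x))
    (λ r x → ≈ᴹ-trans (-ᴹ‿cong (f.*ₗ-homo r x)) (≈ᴹ-sym (*ₗ-neg r (⟦ f ⟧ x))))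
    where
    module f = End f

  _·ₑ_ : 𝔽 → End F V → End F V
  a ·ₑ f = linear (λ x → a *ₗ ⟦ f ⟧ x)
    (λ e → *ₗ-cong reflF (f.⟦⟧-cong e))
    (λ x y → ≈ᴹ-trans (*ₗ-cong reflF (f.+ᴹ-homo x y))
      (*ₗ-distribˡ a (⟦ f ⟧ x) (⟦ f ⟧ y)))
    (≈ᴹ-trans (*ₗ-cong reflF f.0ᴹ-homo) (*ₗ-zeroʳ a))
    (λ x → ≈ᴹ-trans (*ₗ-cong reflF (f.-ᴹ-homo x)) (*ₗ-neg a (⟦ f ⟧ x)))
    (λ r x → ≈ᴹ-trans (*ₗ-cong reflF (f.*ₗ-homo r x)) (*ₗ-swap a r (⟦ f ⟧ x)))
    where
    module f = End f

  _-ₑ_ : End F V → End F V → End F V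
  f -ₑ g = f +ₑ (-ₑ g)

  -- Indices are (row, column): f (b j) = Σᵢ (matrix b f i j) b i.
  matrix : ∀ {n} → Basis F V n → End F V → Fin n → Fin n → 𝔽
  matrix b f i j = coord F V b (⟦ f ⟧ (proj₁ b j)) i

  -- The trace does not depend on the basis b, which is needed only to compute it.
  trace : ∀ {n} → Basis F V n → End F V → 𝔽
  trace b f = sumF λ i → matrix b f i i
    where open Sum +-commutativeMonoid renaming (sum to sumF)

  Diagonal : ∀ {n} → (Fin n → Fin n → 𝔽) → Set ℓ
  Diagonal M = ∀ i j → i ≢ j → M i j ≈𝔽 0𝔽

  record IrreducibleTridiagonal {n : ℕ} (M : Fin n → Fin n → 𝔽) : Set ℓ where
    field
      tridiagonal : ∀ i j → 1 < ∣ toℕ i - toℕ j ∣ → M i j ≈𝔽 0𝔽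
      irreducible : ∀ i j → ∣ toℕ i - toℕ j ∣ ≡ 1 → ¬ (M i j ≈𝔽 0𝔽)

  IsEigenvector : End F V → 𝔽 → Carrierᴹ → Set ℓm
  IsEigenvector f θ v = ¬ (v ≈ᴹ 0ᴹ) × ⟦ f ⟧ v ≈ᴹ θ *ₗ v

  -- For diagonalizable f, the projection onto the θ-eigenspace along the sum
  -- of the other eigenspaces is the linear map that is the identity on the
  -- former and zero on each of the latter.
  record IsPrimitiveIdempotent (f : End F V) (θ : 𝔽) (E : End F V) :
         Set (c ⊔ ℓ ⊔ m ⊔ ℓm) where
    field
      eigenvalue : ∃ (IsEigenvector f θ)
      onto       : ∀ v → ⟦ f ⟧ v ≈ᴹ θ *ₗ v → ⟦ E ⟧ v ≈ᴹ v
      along      : ∀ η → ¬ (η ≈𝔽 θ) →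
                   ∀ v → ⟦ f ⟧ v ≈ᴹ η *ₗ v → ⟦ E ⟧ v ≈ᴹ 0ᴹ

  TridiagonalDiagonal : ∀ {n} → End F V → End F V → Basis F V n → Set ℓ
  TridiagonalDiagonal f g b =
    IrreducibleTridiagonal (matrix b f) × Diagonal (matrix b g)

  record IsLeonardPair (n : ℕ) (A A* : End F V) : Set (c ⊔ ℓ ⊔ m ⊔ ℓm) where
    field
      basis* : ∃ λ (b : Basis F V n) → TridiagonalDiagonal A A* b
      basis  : ∃ λ (b : Basis F V n) → TridiagonalDiagonal A* A b

  -- The eigenvalues θ i of f are automatically exhaustive and, as f is
  -- multiplicity-free, pairwise distinct.
  record IsStandardOrdering {n : ℕ} (f g : End F V) (E : Vector (End F V) n) :
         Set (c ⊔ ℓ ⊔ m ⊔ ℓm) where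
    field
      eigenbasis  : Basis F V n
      θ           : Vector 𝔽 n
      eigenvector : ∀ i → IsEigenvector f (θ i) (proj₁ eigenbasis i)
      standard    : TridiagonalDiagonal g f eigenbasis
      idempotent  : ∀ i → IsPrimitiveIdempotent f (θ i) (E i)

module _ {c ℓ m ℓm : Level} (F : Field c ℓ) (V : VectorSpace F m ℓm) where
  open LeftModule V

  EndSpace : VectorSpace F (c ⊔ m ⊔ ℓm) (m ⊔ ℓm)
  EndSpace = record
    { Carrierᴹ = End F V
    ; _≈ᴹ_ = _≈ₑ_
    ; _+ᴹ_ = _+ₑ_
    ; _*ₗ_ = _·ₑ_
    ; 0ᴹ = 0ₑ
    ; -ᴹ_ = -ₑ_
    ; isLeftModule = record
      { isLeftSemimodule = record
        { +ᴹ-isCommutativeMonoid = record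
          { isMonoid = record
            { isSemigroup = record
              { isMagma = record
                { isEquivalence = record
                  { refl = λ _ → ≈ᴹ-refl
                  ; sym = λ e x → ≈ᴹ-sym (e x)
                  ; trans = λ e e′ x → ≈ᴹ-trans (e x) (e′ x) }
                ; ∙-cong = λ e e′ x → +ᴹ-cong (e x) (e′ x) }
              ; assoc = λ f g h x → +ᴹ-assoc _ _ _ }
            ; identity = (λ f x → +ᴹ-identityˡ _) , (λ f x → +ᴹ-identityʳ _) }
          ; comm = λ f g x → +ᴹ-comm _ _ }
        ; isPreleftSemimodule = record
          { *ₗ-cong = λ r e x → *ₗ-cong r (e x)
          ; *ₗ-zeroˡ = λ f x → *ₗ-zeroˡ _
          ; *ₗ-distribʳ = λ f r s x → *ₗ-distribʳ _ r s
          ; *ₗ-identityˡ = λ f x → *ₗ-identityˡ _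
          ; *ₗ-assoc = λ r s f x → *ₗ-assoc r s _
          ; *ₗ-zeroʳ = λ r x → *ₗ-zeroʳ r
          ; *ₗ-distribˡ = λ r f g x → *ₗ-distribˡ r _ _ } }
      ; -ᴹ‿cong = λ e x → -ᴹ‿cong (e x)
      ; -ᴹ‿inverse = (λ f x → -ᴹ‿inverseˡ _) , (λ f x → -ᴹ‿inverseʳ _) } }

  record LeonardSystem (d : ℕ) : Set (c ⊔ ℓ ⊔ m ⊔ ℓm) where
    field
      A           : End F V
      E           : Vector (End F V) (suc d)
      A*          : End F V
      E*          : Vector (End F V) (suc d)
      leonardPair : IsLeonardPair (suc d) A A*
      E-standard  : IsStandardOrdering A A* E
      E*-standard : IsStandardOrdering A* A E*

module _ {c ℓ m ℓm : Level} {F : Field c ℓ} {V : VectorSpace F m ℓm} where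

  ZeroDiagonalSpace : ∀ {d} → LeonardSystem F V d → Pred (End F V) (c ⊔ m ⊔ ℓm)
  ZeroDiagonalSpace Φ X =
    Span F (EndSpace F V) (idₑ ∷ A* ∷ A ∷ A ∘ₑ A* ∷ []) X ×
    (∀ i → E* i ∘ₑ X ∘ₑ E* i ≈ₑ 0ₑ)
    where open LeonardSystem Φ

{-# OPTIONS --safe #-}

-- An element e₀ + e₁ A* + e₂ A + e₃ A A* has zero diagonal iff
-- (e₀ + e₁ θᵢ) + (e₂ + e₃ θᵢ) aᵢ = 0 for all i, where θᵢ are the (pairwise
-- distinct) eigenvalues of A* and aᵢ is the i-th diagonal entry of A in the
-- eigenbasis of A*.  If two independent tuples satisfy these relations, then
-- elimination shows that every aᵢ equals a₀, and the relations become
-- (e₀ + a₀ e₂) + (e₁ + a₀ e₃) θᵢ = 0, that is e₀ = - a₀ e₂ and e₁ = - a₀ e₃.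
-- Equality of scalars need not be decidable, so no pivot can be chosen in the
-- elimination; instead s = aᵢ - aⱼ is shown to annihilate the tuples, whence
-- s = 0 by independence.
module Submission where

open import Algebra.Bundles using (CommutativeMonoid)
open import Algebra.Module.Bundles using (LeftModule)
import Algebra.Module.Construct.TensorUnit as TensorUnit
import Algebra.Properties.CommutativeMonoid.Sum as Sum
import Algebra.Properties.Group as GroupProperties
import Algebra.Properties.Ring as RingProperties
import Algebra.Solver.CommutativeMonoid as CommutativeMonoidSolver
import Algebra.Solver.Ring.NaturalCoefficients.Default as SemiringSolver
open import Data.Bool.Base using (if_then_else_)
open import Data.Fin.Base using (Fin; zero; suc; toℕ; inject₁; punchIn)
import Data.Fin.Base as Fin
open import Data.Fin.Induction using (<-wellFounded)
open import Data.Fin.Patterns using (0F; 1F; 2F; 3F)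
open import Data.Fin.Properties using (_≟_; punchInᵢ≢i; toℕ-inject₁; toℕ-injective)
open import Data.Nat.Base using (ℕ; zero; suc; _≤_; _<_; ∣_-_∣; s≤s)
import Data.Nat.Properties as ℕ
open import Data.Product.Base using (_×_; _,_; proj₁; proj₂)
open import Data.Unit.Base using (tt)
open import Data.Vec.Functional using (Vector; []; _∷_)
open import Function.Base using (_∘_)
open import Induction.WellFounded using (Acc; acc)
open import Level using (Level)
open import Relation.Binary.Definitions using (tri<; tri≈; tri>)
import Relation.Binary.Reasoning.Setoid as SetoidReasoning
open import Relation.Binary.PropositionalEquality as ≡ using (_≡_; _≢_)
open import Relation.Nullary using (¬_; yes; no; does; contradiction)
open import Defs

-- Sums with one surviving term, and the Kronecker delta.

module _ {c ℓ : Level} (M : CommutativeMonoid c ℓ) where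
  open CommutativeMonoid M
  open Sum M using (sum; sum-remove; sum-cong-≋; sum-replicate-zero)

  sum-zero : ∀ {n} (t : Vector Carrier n) → (∀ j → t j ≈ ε) → sum t ≈ ε
  sum-zero {n} t t≈0 = trans (sum-cong-≋ t≈0) (sum-replicate-zero n)

  sum-single : ∀ {n} i (t : Vector Carrier n) →
               (∀ j → j ≢ i → t j ≈ ε) → sum t ≈ t i
  sum-single {suc n} i t t≈0 =
    trans (sum-remove {i = i} t)
      (trans (∙-congˡ (sum-zero _ λ j → t≈0 (punchIn i j) (punchInᵢ≢i i j)))
        (identityʳ (t i)))

module _ {c ℓ : Level} (F : Field c ℓ) where
  open Field F hiding (zero)

  -- The Kronecker delta, read as the `i`-th standard coordinate vector.
  indicator : ∀ {n} → Fin n → Vector Carrier n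
  indicator i j = if does (i ≟ j) then 1# else 0#

  indicator-diagonal : ∀ {n} (i : Fin n) → indicator i i ≈ 1#
  indicator-diagonal i with i ≟ i
  ... | yes _  = refl
  ... | no i≢i = contradiction ≡.refl i≢i

  indicator-off-diagonal : ∀ {n} {i j : Fin n} → j ≢ i → indicator i j ≈ 0#
  indicator-off-diagonal {i = i} {j} j≢i with i ≟ j
  ... | yes i≡j = contradiction (≡.sym i≡j) j≢i
  ... | no _    = refl

-- Cancellation in a field and polynomials with too many roots.

module FieldLemmas {c ℓ : Level} (F : Field c ℓ) where
  open Field F
  open RingProperties ring using ([y-z]x≈yx-zx)
  open GroupProperties +-group using (x∙y⁻¹≈ε⇒x≈y; x≈y⇒x∙y⁻¹≈ε)
  open SemiringSolver commutativeSemiring using (solve; _:+_; _:*_; _:=_)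
  open SetoidReasoning setoid

  x*0≈0 : ∀ x {y} → y ≈ 0# → x * y ≈ 0#
  x*0≈0 x y≈0 = trans (*-congˡ y≈0) (zeroʳ x)

  0*x≈0 : ∀ {x} y → x ≈ 0# → x * y ≈ 0#
  0*x≈0 y x≈0 = trans (*-congʳ x≈0) (zeroˡ y)

  0+0≈0 : ∀ {x y} → x ≈ 0# → y ≈ 0# → x + y ≈ 0#
  0+0≈0 x≈0 y≈0 = trans (+-cong x≈0 y≈0) (+-identityˡ 0#)

  x+0≈0⇒x≈0 : ∀ {x y} → x + y ≈ 0# → y ≈ 0# → x ≈ 0#
  x+0≈0⇒x≈0 {x} {y} x+y≈0 y≈0 = begin
    x      ≈⟨ +-identityʳ x ⟨
    x + 0# ≈⟨ +-congˡ y≈0 ⟨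
    x + y  ≈⟨ x+y≈0 ⟩
    0#     ∎

  -x≈0⇒x≈0 : ∀ {x} → - x ≈ 0# → x ≈ 0#
  -x≈0⇒x≈0 {x} -x≈0 = begin
    x       ≈⟨ +-identityʳ x ⟨
    x + 0#  ≈⟨ +-congˡ -x≈0 ⟨
    x + - x ≈⟨ -‿inverseʳ x ⟩
    0#      ∎

  nonzero-cancelˡ : ∀ {r x} → ¬ (r ≈ 0#) → r * x ≈ 0# → x ≈ 0#
  nonzero-cancelˡ {r} {x} r≉0 rx≈0 = begin
    x              ≈⟨ *-identityˡ x ⟨
    1# * x         ≈⟨ *-congʳ r*r⁻¹≈1 ⟨
    (r * r⁻¹) * x  ≈⟨ *-congʳ (*-comm r r⁻¹) ⟩
    (r⁻¹ * r) * x  ≈⟨ *-assoc r⁻¹ r x ⟩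
    r⁻¹ * (r * x)  ≈⟨ x*0≈0 r⁻¹ rx≈0 ⟩
    0#             ∎
    where
    r⁻¹ = proj₁ (inverse r r≉0)
    r*r⁻¹≈1 = proj₂ (inverse r r≉0)

  -- The equation is stated without subtraction, so that an identity of commutative semirings can
  -- supply it; the vanishing terms `y` and `z` make both sides match.
  difference-annihilates : ∀ s t {x y z} → y ≈ 0# → z ≈ 0# →
    s * x + y ≈ t * x + z → (s - t) * x ≈ 0#
  difference-annihilates s t {x} {y} {z} y≈0 z≈0 eq = begin
    (s - t) * x    ≈⟨ [y-z]x≈yx-zx x s t ⟩
    s * x - t * x  ≈⟨ x≈y⇒x∙y⁻¹≈ε sx≈tx ⟩
    0#             ∎
    where
    sx≈tx : s * x ≈ t * x
    sx≈tx = begin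
      s * x       ≈⟨ +-identityʳ (s * x) ⟨
      s * x + 0#  ≈⟨ +-congˡ y≈0 ⟨
      s * x + y   ≈⟨ eq ⟩
      t * x + z   ≈⟨ +-congˡ z≈0 ⟩
      t * x + 0#  ≈⟨ +-identityʳ (t * x) ⟩
      t * x       ∎

  -- Nothing is cancelled, so this also applies to `a i` and `a j`, whose difference is not known to
  -- be zero or invertible.
  linear-difference : ∀ {x y s t} →
    x + y * s ≈ 0# → x + y * t ≈ 0# → (s - t) * y ≈ 0#
  linear-difference {x} {y} {s} {t} root-s root-t =
    difference-annihilates s t root-t root-s
      (solve 4 (λ x y s t → s :* y :+ (x :+ y :* t) := t :* y :+ (x :+ y :* s))
        refl x y s t)

  distinct-cancel : ∀ {s t x} → ¬ (s ≈ t) → (s - t) * x ≈ 0# → x ≈ 0#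
  distinct-cancel {s} {t} s≉t = nonzero-cancelˡ (s≉t ∘ x∙y⁻¹≈ε⇒x≈y s t)

  linear-zero : ∀ {x y s t} → ¬ (s ≈ t) →
    x + y * s ≈ 0# → x + y * t ≈ 0# → x ≈ 0# × y ≈ 0#
  linear-zero {s = s} s≉t root-s root-t =
    x+0≈0⇒x≈0 root-s (0*x≈0 s y≈0) , y≈0
    where
    y≈0 = distinct-cancel s≉t (linear-difference root-s root-t)

  quadratic-zero : ∀ {x y z r s t} → ¬ (r ≈ s) → ¬ (r ≈ t) → ¬ (s ≈ t) →
    x + (y + z * r) * r ≈ 0# → x + (y + z * s) * s ≈ 0# →
    x + (y + z * t) * t ≈ 0# → x ≈ 0# × y ≈ 0# × z ≈ 0#
  quadratic-zero {x} {y} {z} {r} {s} {t} r≉s r≉t s≉t root-r root-s root-t =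
    x≈0 , y≈0 , z≈0
    where
    -- Dividing the difference of the values at `r` and `u` by `r - u` leaves a polynomial linear in
    -- `u`, with the two roots `s` and `t`.
    divided-difference : ∀ {u} → ¬ (r ≈ u) → x + (y + z * u) * u ≈ 0# →
                         (y + z * r) + z * u ≈ 0#
    divided-difference {u} r≉u root-u =
      distinct-cancel r≉u (difference-annihilates r u root-u root-r
        (solve 5 (λ x y z r u →
            r :* ((y :+ z :* r) :+ z :* u) :+ (x :+ (y :+ z :* u) :* u)
            := u :* ((y :+ z :* r) :+ z :* u) :+ (x :+ (y :+ z :* r) :* r))
          refl x y z r u))
    linear = linear-zero s≉t (divided-difference r≉s root-s)
                             (divided-difference r≉t root-t)
    z≈0 = proj₂ linear
    y≈0 = x+0≈0⇒x≈0 (proj₁ linear) (0*x≈0 r z≈0)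
    x≈0 = x+0≈0⇒x≈0 root-r (0*x≈0 r (0+0≈0 y≈0 (0*x≈0 r z≈0)))

  -- Elimination in the relations for a zero diagonal.

  module DiagonalRelations {n : ℕ} (θ a : Vector Carrier (suc (suc (suc n))))
    (θ-distinct : ∀ i j → i ≢ j → ¬ (θ i ≈ θ j)) where

    Relation : Vector Carrier 4 → Set ℓ
    Relation e = ∀ i → (e 0F + e 1F * θ i) + (e 2F + e 3F * θ i) * a i ≈ 0#

    θ₀≉θ₁ = θ-distinct 0F 1F (λ ())
    θ₀≉θ₂ = θ-distinct 0F 2F (λ ())
    θ₁≉θ₂ = θ-distinct 1F 2F (λ ())

    combination : ∀ r s e f → Relation e → Relation f →
                  Relation (λ l → r * e l + s * f l)
    combination r s e f rel-e rel-f i = begin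
      _ ≈⟨ solve 12 (λ r s e₀ e₁ e₂ e₃ f₀ f₁ f₂ f₃ t u →
             ((r :* e₀ :+ s :* f₀) :+ (r :* e₁ :+ s :* f₁) :* t)
             :+ ((r :* e₂ :+ s :* f₂) :+ (r :* e₃ :+ s :* f₃) :* t) :* u
             := r :* ((e₀ :+ e₁ :* t) :+ (e₂ :+ e₃ :* t) :* u)
             :+ s :* ((f₀ :+ f₁ :* t) :+ (f₂ :+ f₃ :* t) :* u))
           refl r s (e 0F) (e 1F) (e 2F) (e 3F) (f 0F) (f 1F) (f 2F) (f 3F)
           (θ i) (a i) ⟩
      _ ≈⟨ 0+0≈0 (x*0≈0 r (rel-e i)) (x*0≈0 s (rel-f i)) ⟩
      0# ∎

    -- Once `s` kills the last two entries, `s` times the relation is linear in `θ i` alone, and two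
    -- distinct roots kill the first two entries.
    annihilates-all : ∀ s e → Relation e → s * e 2F ≈ 0# → s * e 3F ≈ 0# →
                      ∀ l → s * e l ≈ 0#
    annihilates-all s e rel se₂≈0 se₃≈0 = λ
      { 0F → proj₁ se₀₁≈0 ; 1F → proj₂ se₀₁≈0 ; 2F → se₂≈0 ; 3F → se₃≈0 }
      where
      root : ∀ i → s * e 0F + s * e 1F * θ i ≈ 0#
      root i = x+0≈0⇒x≈0
        (trans (solve 7 (λ s e₀ e₁ e₂ e₃ t u →
            (s :* e₀ :+ s :* e₁ :* t) :+ (s :* e₂ :+ s :* e₃ :* t) :* u
            := s :* ((e₀ :+ e₁ :* t) :+ (e₂ :+ e₃ :* t) :* u))
          refl s (e 0F) (e 1F) (e 2F) (e 3F) (θ i) (a i))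
          (x*0≈0 s (rel i)))
        (0*x≈0 (a i) (0+0≈0 se₂≈0 (0*x≈0 (θ i) se₃≈0)))
      se₀₁≈0 = linear-zero θ₀≉θ₁ (root 0F) (root 1F)

    -- Multiplying the relation of f by θ i and adding that of g eliminates a i
    -- and leaves a quadratic in θ i with too many roots.
    eliminate : ∀ f g → Relation f → Relation g →
      f 3F ≈ 0# → g 2F ≈ 0# → f 2F + g 3F ≈ 0# →
      g 0F ≈ 0# × f 0F + g 1F ≈ 0# × f 1F ≈ 0#
    eliminate f g rel-f rel-g f₃≈0 g₂≈0 f₂+g₃≈0 =
      quadratic-zero θ₀≉θ₁ θ₀≉θ₂ θ₁≉θ₂ (root 0F) (root 1F) (root 2F)
      where
      root : ∀ i → g 0F + (f 0F + g 1F + f 1F * θ i) * θ i ≈ 0#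
      root i = x+0≈0⇒x≈0
        (trans (solve 10 (λ f₀ f₁ f₂ f₃ g₀ g₁ g₂ g₃ t u →
            (g₀ :+ (f₀ :+ g₁ :+ f₁ :* t) :* t)
            :+ ((f₂ :+ g₃) :* t :+ (g₂ :+ f₃ :* (t :* t))) :* u
            := t :* ((f₀ :+ f₁ :* t) :+ (f₂ :+ f₃ :* t) :* u)
            :+ ((g₀ :+ g₁ :* t) :+ (g₂ :+ g₃ :* t) :* u))
          refl (f 0F) (f 1F) (f 2F) (f 3F) (g 0F) (g 1F) (g 2F) (g 3F)
          (θ i) (a i))
          (0+0≈0 (x*0≈0 (θ i) (rel-f i)) (rel-g i)))
        (0*x≈0 (a i) (0+0≈0 (0*x≈0 (θ i) f₂+g₃≈0)
                            (0+0≈0 g₂≈0 (0*x≈0 (θ i * θ i) f₃≈0))))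

    -- The 2×2 minor in columns `k` and `l` of the matrix with rows `e` and `f`. For fixed `k` it is
    -- a combination of the two rows, written in the shape that `combination` produces, and
    -- therefore satisfies the relations.
    minor : Vector Carrier 4 → Vector Carrier 4 → Fin 4 → Fin 4 → Carrier
    minor e f k l = - f k * e l + e k * f l

    minor-antisym : ∀ e f k l → minor e f k l + minor e f l k ≈ 0#
    minor-antisym e f k l = begin
      _ ≈⟨ solve 6 (λ p q x y m n →
             (m :* y :+ x :* q) :+ (n :* x :+ y :* p)
             := x :* (n :+ q) :+ y :* (m :+ p))
           refl (f k) (f l) (e k) (e l) (- f k) (- f l) ⟩
      e k * (- f l + f l) + e l * (- f k + f k)
        ≈⟨ 0+0≈0 (x*0≈0 (e k) (-‿inverseˡ (f l))) (x*0≈0 (e l) (-‿inverseˡ (f k))) ⟩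
      0# ∎

    minor-diagonal : ∀ e f k → minor e f k k ≈ 0#
    minor-diagonal e f k = begin
      - f k * e k + e k * f k   ≈⟨ +-congʳ (*-comm (- f k) (e k)) ⟩
      e k * - f k + e k * f k   ≈⟨ distribˡ (e k) (- f k) (f k) ⟨
      e k * (- f k + f k)       ≈⟨ x*0≈0 (e k) (-‿inverseˡ (f k)) ⟩
      0#                        ∎

    constant : ∀ e f → Relation e → Relation f →
      (∀ r s → (∀ l → r * e l + s * f l ≈ 0#) → r ≈ 0# × s ≈ 0#) →
      ∀ i j → a i ≈ a j
    constant e f rel-e rel-f independent i j =
      x∙y⁻¹≈ε⇒x≈y (a i) (a j) s≈0
      where
      s = a i - a j

      rel-minor : ∀ k → Relation (minor e f k)
      rel-minor k = combination (- f k) (e k) e f rel-e rel-f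

      -- The coefficient of `a i` left by the elimination consists of the minors 33 and 22 and the
      -- sum of 32 and 23, all zero because minors alternate.
      eliminated = eliminate (minor e f 3F) (minor e f 2F) (rel-minor 3F) (rel-minor 2F)
        (minor-diagonal e f 3F) (minor-diagonal e f 2F) (minor-antisym e f 3F 2F)

      -- The elimination also gives that the minor 31 is zero, so the relation of row 3 loses its
      -- terms in `θ i`. What remains is one linear equation satisfied by every `a i`.
      minor-root : ∀ i → minor e f 3F 0F + minor e f 3F 2F * a i ≈ 0#
      minor-root i = x+0≈0⇒x≈0
        (trans (solve 6 (λ f₀ f₁ f₂ f₃ t u →
             (f₀ :+ f₂ :* u) :+ (f₁ :* t :+ f₃ :* t :* u)
             := (f₀ :+ f₁ :* t) :+ (f₂ :+ f₃ :* t) :* u)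
           refl (minor e f 3F 0F) (minor e f 3F 1F) (minor e f 3F 2F)
             (minor e f 3F 3F) (θ i) (a i))
          (rel-minor 3F i))
        (0+0≈0 (0*x≈0 (θ i) (proj₂ (proj₂ eliminated)))
               (0*x≈0 (a i) (0*x≈0 (θ i) (minor-diagonal e f 3F))))

      s-minor₃₂ : s * minor e f 3F 2F ≈ 0#
      s-minor₃₂ = linear-difference (minor-root i) (minor-root j)

      s-minor₂₃ : s * minor e f 2F 3F ≈ 0#
      s-minor₂₃ = x+0≈0⇒x≈0
        (trans (sym (distribˡ s _ _)) (x*0≈0 s (minor-antisym e f 2F 3F)))
        s-minor₃₂

      -- All of `s` times row `k` of minors vanishes. This row is the combination of `e` and `f`
      -- with coefficients `s * - f k` and `s * e k`, so independence kills the latter.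
      annihilates-entry : ∀ k → s * minor e f k 2F ≈ 0# →
                          s * minor e f k 3F ≈ 0# → s * e k ≈ 0#
      annihilates-entry k s-k₂ s-k₃ = proj₂ (independent (s * - f k) (s * e k)
        (λ l → trans (solve 5 (λ s x y n q →
                        (s :* n) :* y :+ (s :* x) :* q
                        := s :* (n :* y :+ x :* q))
                      refl s (e k) (e l) (- f k) (f l))
                 (annihilates-all s (minor e f k) (rel-minor k) s-k₂ s-k₃ l)))

      s≈0 : s ≈ 0#
      -- Now `s` kills the last two entries of `e`, hence all of `e`, which is a dependence with
      -- second coefficient zero.
      s≈0 = proj₁ (independent s 0# λ l → 0+0≈0
        (annihilates-all s e rel-e
          (annihilates-entry 2F (x*0≈0 s (minor-diagonal e f 2F)) s-minor₂₃)
          (annihilates-entry 3F s-minor₃₂ (x*0≈0 s (minor-diagonal e f 3F))) l)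
        (zeroˡ (f l)))

-- Linear combinations and linear maps.

module VectorSpaceLemmas {c ℓ m ℓm : Level} (F : Field c ℓ) (V : VectorSpace F m ℓm) where
  open Field F hiding (zero)
  open LeftModule V
  open Sum +ᴹ-commutativeMonoid using (sum; sum-cong-≋; ∑-distrib-+)
  open RingProperties ring using (-1*x≈-x)
  open GroupProperties +-group using (x∙y⁻¹≈ε⇒x≈y)
  open SetoidReasoning ≈ᴹ-setoid

  0*ₗx≈0 : ∀ {r} x → r ≈ 0# → r *ₗ x ≈ᴹ 0ᴹ
  0*ₗx≈0 x r≈0 = ≈ᴹ-trans (*ₗ-cong r≈0 ≈ᴹ-refl) (*ₗ-zeroˡ x)

  r*ₗ0≈0 : ∀ r {x} → x ≈ᴹ 0ᴹ → r *ₗ x ≈ᴹ 0ᴹ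
  r*ₗ0≈0 r x≈0 = ≈ᴹ-trans (*ₗ-cong refl x≈0) (*ₗ-zeroʳ r)

  *ₗ-swap : ∀ r s x → r *ₗ s *ₗ x ≈ᴹ s *ₗ r *ₗ x
  *ₗ-swap r s x = ≈ᴹ-trans (≈ᴹ-sym (*ₗ-assoc r s x))
    (≈ᴹ-trans (*ₗ-cong (*-comm r s) ≈ᴹ-refl) (*ₗ-assoc s r x))

  module _ {n : ℕ} (v : Vector Carrierᴹ n) where

    linComb-cong : ∀ {a b : Vector Carrier n} → (∀ i → a i ≈ b i) →
                   linComb F V a v ≈ᴹ linComb F V b v
    linComb-cong a≈b = sum-cong-≋ λ i → *ₗ-cong (a≈b i) ≈ᴹ-refl

    linComb-zero : ∀ (a : Vector Carrier n) → (∀ i → a i ≈ 0#) →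
                   linComb F V a v ≈ᴹ 0ᴹ
    linComb-zero a a≈0 =
      sum-zero +ᴹ-commutativeMonoid (λ i → a i *ₗ v i) λ i → 0*ₗx≈0 (v i) (a≈0 i)

    linComb-+ : ∀ (a b : Vector Carrier n) →
      linComb F V (λ i → a i + b i) v ≈ᴹ linComb F V a v +ᴹ linComb F V b v
    linComb-+ a b = ≈ᴹ-trans (sum-cong-≋ λ i → *ₗ-distribʳ (v i) (a i) (b i))
      (∑-distrib-+ (λ i → a i *ₗ v i) (λ i → b i *ₗ v i))

    linComb-indicator : ∀ i → linComb F V (indicator F i) v ≈ᴹ v i
    linComb-indicator i = begin
      linComb F V (indicator F i) v
        ≈⟨ sum-single +ᴹ-commutativeMonoid i (λ j → indicator F i j *ₗ v j)
             (λ j j≢i → 0*ₗx≈0 (v j) (indicator-off-diagonal F j≢i)) ⟩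
      indicator F i i *ₗ v i  ≈⟨ *ₗ-cong (indicator-diagonal F i) ≈ᴹ-refl ⟩
      1# *ₗ v i               ≈⟨ *ₗ-identityˡ (v i) ⟩
      v i                     ∎

  module _ {m′ ℓm′ : Level} (W : VectorSpace F m′ ℓm′)
    (φ : Carrierᴹ → LeftModule.Carrierᴹ W) where
    private module W = LeftModule W

    module LinearMap
      (φ-cong : ∀ {x y} → x ≈ᴹ y → φ x W.≈ᴹ φ y)
      (φ-+ : ∀ x y → φ (x +ᴹ y) W.≈ᴹ φ x W.+ᴹ φ y)
      (φ-* : ∀ r x → φ (r *ₗ x) W.≈ᴹ r W.*ₗ φ x) where

      -- The map is a bare function into any vector space, which covers endomorphisms, scalings and
      -- linear functionals alike.
      linComb-homo : ∀ {n} (a : Vector Carrier n) (v : Vector Carrierᴹ n) →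
                     φ (linComb F V a v) W.≈ᴹ linComb F W a (φ ∘ v)
      -- Preservation of zero comes from homogeneity, by writing `0ᴹ` as `0# *ₗ 0ᴹ`.
      linComb-homo {zero}  a v = W.≈ᴹ-trans (φ-cong (≈ᴹ-sym (*ₗ-zeroˡ 0ᴹ)))
        (W.≈ᴹ-trans (φ-* 0# 0ᴹ) (W.*ₗ-zeroˡ (φ 0ᴹ)))
      linComb-homo {suc n} a v = W.≈ᴹ-trans (φ-+ _ _)
        (W.+ᴹ-cong (φ-* (a zero) (v zero)) (linComb-homo (a ∘ suc) (v ∘ suc)))

  linComb-*ₗ : ∀ {n} (v : Vector Carrierᴹ n) r (a : Vector Carrier n) →
    linComb F V (λ i → r * a i) v ≈ᴹ r *ₗ linComb F V a v
  linComb-*ₗ v r a = begin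
    linComb F V (λ i → r * a i) v
      ≈⟨ (sum-cong-≋ λ i → ≈ᴹ-trans (*ₗ-assoc r (a i) (v i)) (*ₗ-swap r (a i) (v i))) ⟩
    linComb F V a (λ i → r *ₗ v i)
      ≈⟨ LinearMap.linComb-homo V (r *ₗ_) (*ₗ-cong refl) (*ₗ-distribˡ r)
           (*ₗ-swap r) a v ⟨
    r *ₗ linComb F V a v ∎

  -- Carries a dependence between coefficient tuples over to the vectors that they represent.
  linComb₂ : ∀ {n} (v : Vector Carrierᴹ n) {w : Vector Carrierᴹ 2}
    (e f : Vector Carrier n) →
    w 0F ≈ᴹ linComb F V e v → w 1F ≈ᴹ linComb F V f v →
    ∀ a → linComb F V a w ≈ᴹ linComb F V (λ l → a 0F * e l + a 1F * f l) v
  linComb₂ v {w} e f w₀≈ w₁≈ a = begin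
    a 0F *ₗ w 0F +ᴹ (a 1F *ₗ w 1F +ᴹ 0ᴹ)
      ≈⟨ +ᴹ-cong (*ₗ-cong refl w₀≈)
           (≈ᴹ-trans (+ᴹ-identityʳ _) (*ₗ-cong refl w₁≈)) ⟩
    a 0F *ₗ linComb F V e v +ᴹ a 1F *ₗ linComb F V f v
      ≈⟨ +ᴹ-cong (linComb-*ₗ v (a 0F) e) (linComb-*ₗ v (a 1F) f) ⟨
    linComb F V (λ l → a 0F * e l) v +ᴹ linComb F V (λ l → a 1F * f l) v
      ≈⟨ linComb-+ v (λ l → a 0F * e l) (λ l → a 1F * f l) ⟨
    linComb F V (λ l → a 0F * e l + a 1F * f l) v ∎

  independent⇒linComb-injective : ∀ {n} {v : Vector Carrierᴹ n} →
    LinearlyIndependent F V v → ∀ a b →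
    linComb F V a v ≈ᴹ linComb F V b v → ∀ i → a i ≈ b i
  independent⇒linComb-injective {v = v} independent a b eq i =
    x∙y⁻¹≈ε⇒x≈y (a i) (b i) (trans (+-congˡ (sym (-1*x≈-x (b i))))
      (independent (λ j → a j + - 1# * b j) (begin
        linComb F V (λ j → a j + - 1# * b j) v
          ≈⟨ linComb-+ v a (λ j → - 1# * b j) ⟩
        linComb F V a v +ᴹ linComb F V (λ j → - 1# * b j) v
          ≈⟨ +ᴹ-cong (≈ᴹ-trans eq (≈ᴹ-sym (*ₗ-identityˡ _))) (linComb-*ₗ v (- 1#) b) ⟩
        1# *ₗ linComb F V b v +ᴹ - 1# *ₗ linComb F V b v
          ≈⟨ *ₗ-distribʳ _ 1# (- 1#) ⟨
        (1# + - 1#) *ₗ linComb F V b v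
          ≈⟨ 0*ₗx≈0 _ (-‿inverseʳ 1#) ⟩
        0ᴹ ∎) i))

  -- Coordinates, matrices and traces.

  module Coordinates {n : ℕ} (b : Basis F V n) where
    private
      v = proj₁ b
      module b = IsBasisOf (proj₂ b)

    x≈linComb-coord : ∀ x → x ≈ᴹ linComb F V (coord F V b x) v
    x≈linComb-coord x = proj₂ (b.spans x tt)

    coord-unique : ∀ {x} a → x ≈ᴹ linComb F V a v → ∀ i → coord F V b x i ≈ a i
    coord-unique {x} a x≈a = independent⇒linComb-injective b.independent
      (coord F V b x) a (≈ᴹ-trans (≈ᴹ-sym (x≈linComb-coord x)) x≈a)

    coord-cong : ∀ i {x y} → x ≈ᴹ y → coord F V b x i ≈ coord F V b y i
    coord-cong i {x} {y} x≈y =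
      coord-unique (coord F V b y) (≈ᴹ-trans x≈y (x≈linComb-coord y)) i

    coord-+ : ∀ i x y → coord F V b (x +ᴹ y) i ≈ coord F V b x i + coord F V b y i
    coord-+ i x y = coord-unique (λ j → coord F V b x j + coord F V b y j)
      (≈ᴹ-trans (+ᴹ-cong (x≈linComb-coord x) (x≈linComb-coord y))
        (≈ᴹ-sym (linComb-+ v _ _))) i

    coord-*ₗ : ∀ i r x → coord F V b (r *ₗ x) i ≈ r * coord F V b x i
    coord-*ₗ i r x = coord-unique (λ j → r * coord F V b x j)
      (≈ᴹ-trans (*ₗ-cong refl (x≈linComb-coord x)) (≈ᴹ-sym (linComb-*ₗ v r _))) i

    coord-zero : ∀ i → coord F V b 0ᴹ i ≈ 0#
    coord-zero = coord-unique (λ _ → 0#) (≈ᴹ-sym (linComb-zero v _ λ _ → refl))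

    coord-basis : ∀ i j → coord F V b (v i) j ≈ indicator F i j
    coord-basis i = coord-unique (indicator F i) (≈ᴹ-sym (linComb-indicator v i))

    coord-diagonal : ∀ i → coord F V b (v i) i ≈ 1#
    coord-diagonal i = trans (coord-basis i i) (indicator-diagonal F i)

    coord-off-diagonal : ∀ i j → j ≢ i → coord F V b (v i) j ≈ 0#
    coord-off-diagonal i j j≢i = trans (coord-basis i j) (indicator-off-diagonal F j≢i)

    coord≈0⇒≈0 : ∀ x → (∀ i → coord F V b x i ≈ 0#) → x ≈ᴹ 0ᴹ
    coord≈0⇒≈0 x x≈0 = ≈ᴹ-trans (x≈linComb-coord x) (linComb-zero v _ x≈0)

    functional-expansion : (φ : Carrierᴹ → Carrier) →
      (∀ {x y} → x ≈ᴹ y → φ x ≈ φ y) →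
      (∀ x y → φ (x +ᴹ y) ≈ φ x + φ y) →
      (∀ r x → φ (r *ₗ x) ≈ r * φ x) →
      ∀ x → φ x ≈ Sum.sum +-commutativeMonoid (λ i → coord F V b x i * φ (v i))
    functional-expansion φ φ-cong φ-+ φ-* x =
      trans (φ-cong (x≈linComb-coord x))
        -- The field is taken as a vector space over itself, where a linear combination is a sum of
        -- products.
        (LinearMap.linComb-homo (TensorUnit.leftModule {R = ring}) φ φ-cong φ-+ φ-*
          (coord F V b x) v)

    coord-combination : ∀ i r s x y →
      coord F V b (r *ₗ x +ᴹ s *ₗ y) i ≈ r * coord F V b x i + s * coord F V b y i
    coord-combination i r s x y =
      trans (coord-+ i (r *ₗ x) (s *ₗ y)) (+-cong (coord-*ₗ i r x) (coord-*ₗ i s y))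

    coord-multiple : ∀ i r → coord F V b (r *ₗ v i) i ≈ r
    coord-multiple i r =
      trans (coord-*ₗ i r (v i)) (trans (*-congˡ (coord-diagonal i)) (*-identityʳ r))

    coord-End : ∀ (f : End F V) i x → coord F V b (End.⟦_⟧ f x) i
      ≈ Sum.sum +-commutativeMonoid (λ j → coord F V b x j * matrix b f i j)
    coord-End f i = functional-expansion (λ x → coord F V b (f.⟦_⟧ x) i)
      (coord-cong i ∘ f.⟦⟧-cong)
      (λ x y → trans (coord-cong i (f.+ᴹ-homo x y)) (coord-+ i _ _))
      (λ r x → trans (coord-cong i (f.*ₗ-homo r x)) (coord-*ₗ i r _))
      where module f = End f

    -- The trace sums `φ (v i)` times the `i`-th coordinate of `w`, which is the expansion of `φ w`
    -- in whatever basis is chosen.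
    trace-rank-one : (f : End F V) (w : Carrierᴹ) (φ : Carrierᴹ → Carrier) →
      (∀ {x y} → x ≈ᴹ y → φ x ≈ φ y) →
      (∀ x y → φ (x +ᴹ y) ≈ φ x + φ y) →
      (∀ r x → φ (r *ₗ x) ≈ r * φ x) →
      (∀ x → End.⟦_⟧ f x ≈ᴹ φ x *ₗ w) → trace b f ≈ φ w
    trace-rank-one f w φ φ-cong φ-+ φ-* f≈φw =
      trans (Sum.sum-cong-≋ +-commutativeMonoid λ i →
          trans (coord-cong i (f≈φw (v i)))
            (trans (coord-*ₗ i (φ (v i)) w) (*-comm _ _)))
        (sym (functional-expansion φ φ-cong φ-+ φ-* w))

  -- Eigenvectors of irreducible tridiagonal matrices.

  module Tridiagonal {n : ℕ} (b : Basis F V (suc n)) (f : End F V)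
    (irreducibleTridiagonal : IrreducibleTridiagonal {F = F} {V} (matrix b f)) where
    open IrreducibleTridiagonal {F = F} {V} irreducibleTridiagonal
    open Coordinates b
    open FieldLemmas F using (x*0≈0; 0*x≈0; nonzero-cancelˡ)

    -- Each row of the eigenvalue equation determines the next coordinate from earlier ones, since
    -- the superdiagonal entry is nonzero.
    eigenvector-coord-zero : ∀ {η} x → End.⟦_⟧ f x ≈ᴹ η *ₗ x →
      coord F V b x zero ≈ 0# → ∀ j → coord F V b x j ≈ 0#
    eigenvector-coord-zero {η} x fx≈ηx x₀≈0 j = go j (<-wellFounded j)
      where
      go : ∀ j → Acc Fin._<_ j → coord F V b x j ≈ 0#
      go zero    _         = x₀≈0
      go (suc j) (acc rec) = nonzero-cancelˡ
        (irreducible i (suc j)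
          (≡.trans (≡.cong ∣_- suc (toℕ j) ∣ i≡j) (∣n-1+n∣≡1 (toℕ j))))
        (trans (*-comm _ _) (trans
          (sym (sum-single +-commutativeMonoid (suc j)
            (λ k → coord F V b x k * matrix b f i k) other-terms))
          (trans (sym (coord-End f i x))
            (trans (coord-cong i fx≈ηx) (trans (coord-*ₗ i η x) (x*0≈0 η xᵢ≈0))))))
        where
        -- The row used is the one just above `suc j`, whose superdiagonal entry lies in column
        -- `suc j`.
        i = inject₁ j
        i≡j : toℕ i ≡ toℕ j
        i≡j = toℕ-inject₁ j
        ∣n-1+n∣≡1 : ∀ n → ∣ n - suc n ∣ ≡ 1
        ∣n-1+n∣≡1 zero    = ≡.refl
        ∣n-1+n∣≡1 (suc n) = ∣n-1+n∣≡1 n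
        xᵢ≈0 : coord F V b x i ≈ 0#
        xᵢ≈0 = go i (rec (s≤s (ℕ.≤-reflexive i≡j)))
        2+n≤m⇒1<∣n-m∣ : ∀ n m → suc n < m → 1 < ∣ n - m ∣
        2+n≤m⇒1<∣n-m∣ zero    m       1<m       = 1<m
        2+n≤m⇒1<∣n-m∣ (suc n) (suc m) (s≤s n<m) = 2+n≤m⇒1<∣n-m∣ n m n<m
        other-terms : ∀ k → k ≢ suc j → coord F V b x k * matrix b f i k ≈ 0#
        -- Columns before `suc j` vanish by induction on the coordinates, columns after it by
        -- tridiagonality.
        other-terms k k≢1+j with ℕ.<-cmp (toℕ k) (suc (toℕ j))
        ... | tri< k<1+j _ _ = 0*x≈0 _ (go k (rec k<1+j))
        ... | tri≈ _ k≡1+j _ = contradiction (toℕ-injective k≡1+j) k≢1+j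
        ... | tri> _ _ 1+j<k = x*0≈0 _ (tridiagonal i k
          (2+n≤m⇒1<∣n-m∣ (toℕ i) (toℕ k)
            (≡.subst (λ m → suc m < toℕ k) (≡.sym i≡j) 1+j<k)))

    eigenvector-zero : ∀ {η} x → End.⟦_⟧ f x ≈ᴹ η *ₗ x →
      coord F V b x zero ≈ 0# → x ≈ᴹ 0ᴹ
    eigenvector-zero x fx≈ηx x₀≈0 =
      coord≈0⇒≈0 x (eigenvector-coord-zero x fx≈ηx x₀≈0)

-- Zero diagonal of a Leonard system as relations on coefficients.

module LeonardSystemLemmas {c ℓ m ℓm : Level} (F : Field c ℓ)
  (V : VectorSpace F m ℓm) {d : ℕ} (Φ : LeonardSystem F V (suc (suc d))) where
  open Field F hiding (zero)
  open LeftModule V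
  open LeonardSystem Φ
  open End using (⟦_⟧)
  open RingProperties ring using (-‿distribˡ-*)
  open GroupProperties +-group using (inverseˡ-unique)
  open FieldLemmas F
  open VectorSpaceLemmas F V
  private
    module W = VectorSpaceLemmas F (EndSpace F V)
    module E  = IsStandardOrdering E-standard
    module E* = IsStandardOrdering E*-standard
    β = E*.eigenbasis
    v = proj₁ β
  open Coordinates β
  open E* using (θ)

  linear₂ : ∀ (f : End F V) r s x y →
    ⟦ f ⟧ (r *ₗ x +ᴹ s *ₗ y) ≈ᴹ r *ₗ ⟦ f ⟧ x +ᴹ s *ₗ ⟦ f ⟧ y
  linear₂ f r s x y = ≈ᴹ-trans (f.+ᴹ-homo (r *ₗ x) (s *ₗ y))
    (+ᴹ-cong (f.*ₗ-homo r x) (f.*ₗ-homo s y))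
    where module f = End f

  A*-eigenvector : ∀ i → ⟦ A* ⟧ (v i) ≈ᴹ θ i *ₗ v i
  A*-eigenvector i = proj₂ (E*.eigenvector i)

  -- A* is irreducible tridiagonal in an eigenbasis of A, so that an
  -- eigenvector of A* is determined by its eigenvalue and its first coordinate.
  θ-distinct : ∀ i j → i ≢ j → ¬ (θ i ≈ θ j)
  θ-distinct i j i≢j θi≈θj =
    proj₁ (E*.eigenvector i) (T.eigenvector-zero (v i) (A*-eigenvector i) xᵢ≈0)
    where
    module T = Tridiagonal E.eigenbasis A* (proj₁ E.standard)
    module γ = Coordinates E.eigenbasis
    open SetoidReasoning ≈ᴹ-setoid
    xᵢ = coord F V E.eigenbasis (v i) zero
    xⱼ = coord F V E.eigenbasis (v j) zero
    -- The weights make the first coordinate of `w` in the eigenbasis of `A` cancel.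
    w = xⱼ *ₗ v i +ᴹ - xᵢ *ₗ v j

    A*w≈θw : ⟦ A* ⟧ w ≈ᴹ θ i *ₗ w
    A*w≈θw = begin
      ⟦ A* ⟧ w
        ≈⟨ linear₂ A* xⱼ (- xᵢ) (v i) (v j) ⟩
      xⱼ *ₗ ⟦ A* ⟧ (v i) +ᴹ - xᵢ *ₗ ⟦ A* ⟧ (v j)
        ≈⟨ +ᴹ-cong (*ₗ-cong refl (A*-eigenvector i))
             (*ₗ-cong refl (≈ᴹ-trans (A*-eigenvector j)
               (*ₗ-cong (sym θi≈θj) ≈ᴹ-refl))) ⟩
      xⱼ *ₗ θ i *ₗ v i +ᴹ - xᵢ *ₗ θ i *ₗ v j
        ≈⟨ +ᴹ-cong (*ₗ-swap xⱼ (θ i) (v i)) (*ₗ-swap (- xᵢ) (θ i) (v j)) ⟩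
      θ i *ₗ xⱼ *ₗ v i +ᴹ θ i *ₗ - xᵢ *ₗ v j
        ≈⟨ *ₗ-distribˡ (θ i) _ _ ⟨
      θ i *ₗ w ∎

    w≈0 : w ≈ᴹ 0ᴹ
    w≈0 = T.eigenvector-zero w A*w≈θw
      (trans (γ.coord-combination zero xⱼ (- xᵢ) (v i) (v j))
        (trans (+-cong (*-comm xⱼ xᵢ) (sym (-‿distribˡ-* xᵢ xⱼ)))
          (-‿inverseʳ (xᵢ * xⱼ))))

    xᵢ≈0 : xᵢ ≈ 0#
    -- The coordinate of `w` at `v j` is `- xᵢ`, and `w` is zero.
    xᵢ≈0 = -x≈0⇒x≈0 (trans (sym (*-identityʳ (- xᵢ)))
      (x+0≈0⇒x≈0
        (trans (+-comm _ _)
          (trans (sym (trans (coord-combination j xⱼ (- xᵢ) (v i) (v j))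
                   (+-congˡ (*-congˡ (coord-diagonal j)))))
            (trans (coord-cong j w≈0) (coord-zero j))))
        (x*0≈0 xⱼ (coord-off-diagonal i j (i≢j ∘ ≡.sym)))))

  -- As the eigenvalues are distinct, `E* i` kills every `v j` with `j ≢ i`, and it fixes `v i`.
  E*-projection : ∀ i x → ⟦ E* i ⟧ x ≈ᴹ coord F V β x i *ₗ v i
  E*-projection i x = begin
    ⟦ E* i ⟧ x
      ≈⟨ E*ᵢ.⟦⟧-cong (x≈linComb-coord x) ⟩
    ⟦ E* i ⟧ (linComb F V (coord F V β x) v)
      ≈⟨ LinearMap.linComb-homo V ⟦ E* i ⟧ E*ᵢ.⟦⟧-cong E*ᵢ.+ᴹ-homo E*ᵢ.*ₗ-homo
           (coord F V β x) v ⟩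
    linComb F V (coord F V β x) (⟦ E* i ⟧ ∘ v)
      ≈⟨ sum-single +ᴹ-commutativeMonoid i
           (λ j → coord F V β x j *ₗ ⟦ E* i ⟧ (v j))
           (λ j j≢i → r*ₗ0≈0 _
             (along (θ j) (θ-distinct j i j≢i) (v j) (A*-eigenvector j))) ⟩
    coord F V β x i *ₗ ⟦ E* i ⟧ (v i)
      ≈⟨ *ₗ-cong refl (onto (v i) (A*-eigenvector i)) ⟩
    coord F V β x i *ₗ v i ∎
    where
    open SetoidReasoning ≈ᴹ-setoid
    open IsPrimitiveIdempotent (E*.idempotent i)
    module E*ᵢ = End (E* i)

  -- At `v i` the product `E* i ∘ₑ X ∘ₑ E* i` gives the diagonal entry times `v i`.
  zero-diagonal⇒entry≈0 : ∀ X i → (E* i ∘ₑ X ∘ₑ E* i ≈ₑ 0ₑ) → matrix β X i i ≈ 0#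
  zero-diagonal⇒entry≈0 X i EXE≈0 =
    trans (sym (coord-multiple i _)) (trans (coord-cong i (begin
      matrix β X i i *ₗ v i           ≈⟨ E*-projection i (⟦ X ⟧ (v i)) ⟨
      ⟦ E* i ⟧ (⟦ X ⟧ (v i))
        ≈⟨ End.⟦⟧-cong (E* i) (End.⟦⟧-cong X (onto (v i) (A*-eigenvector i))) ⟨
      ⟦ E* i ⟧ (⟦ X ⟧ (⟦ E* i ⟧ (v i))) ≈⟨ EXE≈0 (v i) ⟩
      0ᴹ                              ∎)) (coord-zero i))
    where
    open SetoidReasoning ≈ᴹ-setoid
    open IsPrimitiveIdempotent (E*.idempotent i)

  entry≈0⇒zero-diagonal : ∀ X i → matrix β X i i ≈ 0# → E* i ∘ₑ X ∘ₑ E* i ≈ₑ 0ₑ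
  entry≈0⇒zero-diagonal X i Xᵢᵢ≈0 x = begin
    ⟦ E* i ⟧ (⟦ X ⟧ (⟦ E* i ⟧ x))
      ≈⟨ End.⟦⟧-cong (E* i) (End.⟦⟧-cong X (E*-projection i x)) ⟩
    ⟦ E* i ⟧ (⟦ X ⟧ (r *ₗ v i))
      ≈⟨ End.⟦⟧-cong (E* i) (End.*ₗ-homo X r (v i)) ⟩
    ⟦ E* i ⟧ (r *ₗ ⟦ X ⟧ (v i))
      ≈⟨ E*-projection i _ ⟩
    coord F V β (r *ₗ ⟦ X ⟧ (v i)) i *ₗ v i
      ≈⟨ 0*ₗx≈0 (v i) (trans (coord-*ₗ i r _) (x*0≈0 r Xᵢᵢ≈0)) ⟩
    0ᴹ ∎
    where
    open SetoidReasoning ≈ᴹ-setoid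
    r = coord F V β x i

  generators : Vector (End F V) 4
  generators = idₑ ∷ A* ∷ A ∷ A ∘ₑ A* ∷ []

  a : Vector Carrier (suc (suc (suc d)))
  a i = matrix β A i i

  open DiagonalRelations θ a θ-distinct

  -- Since `A*` acts on `v i` as `θ i`, the generators `idₑ` and `A*` give multiples of `v i`, and
  -- `A` and `A ∘ₑ A*` give multiples of `⟦ A ⟧ (v i)`.
  combination-eigenvector : ∀ X e → X ≈ₑ linComb F (EndSpace F V) e generators →
    ∀ i → ⟦ X ⟧ (v i) ≈ᴹ (e 0F + e 1F * θ i) *ₗ v i
                         +ᴹ (e 2F + e 3F * θ i) *ₗ ⟦ A ⟧ (v i)
  combination-eigenvector X e X≈ i = begin
    ⟦ X ⟧ (v i)
      ≈⟨ X≈ (v i) ⟩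
    e 0F *ₗ v i +ᴹ (e 1F *ₗ ⟦ A* ⟧ (v i) +ᴹ
      (e 2F *ₗ ⟦ A ⟧ (v i) +ᴹ (e 3F *ₗ ⟦ A ⟧ (⟦ A* ⟧ (v i)) +ᴹ 0ᴹ)))
      ≈⟨ +ᴹ-cong ≈ᴹ-refl (+ᴹ-cong (multiple (e 1F) (A*-eigenvector i))
           (+ᴹ-cong ≈ᴹ-refl (+ᴹ-cong (multiple (e 3F)
             (≈ᴹ-trans (End.⟦⟧-cong A (A*-eigenvector i)) (End.*ₗ-homo A (θ i) (v i))))
             ≈ᴹ-refl))) ⟩
    e 0F *ₗ v i +ᴹ ((e 1F * θ i) *ₗ v i +ᴹ
      (e 2F *ₗ ⟦ A ⟧ (v i) +ᴹ ((e 3F * θ i) *ₗ ⟦ A ⟧ (v i) +ᴹ 0ᴹ)))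
      ≈⟨ solve 4 (λ x y z w → x ⊕ (y ⊕ (z ⊕ (w ⊕ id))) ⊜ (x ⊕ y) ⊕ (z ⊕ w)) ≈ᴹ-refl
           _ _ _ _ ⟩
    (e 0F *ₗ v i +ᴹ (e 1F * θ i) *ₗ v i) +ᴹ
      (e 2F *ₗ ⟦ A ⟧ (v i) +ᴹ (e 3F * θ i) *ₗ ⟦ A ⟧ (v i))
      ≈⟨ +ᴹ-cong (*ₗ-distribʳ _ _ _) (*ₗ-distribʳ _ _ _) ⟨
    (e 0F + e 1F * θ i) *ₗ v i +ᴹ (e 2F + e 3F * θ i) *ₗ ⟦ A ⟧ (v i) ∎
    where
    open SetoidReasoning ≈ᴹ-setoid
    open CommutativeMonoidSolver +ᴹ-commutativeMonoid using (solve; _⊕_; _⊜_; id)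
    multiple : ∀ r {s x y} → x ≈ᴹ s *ₗ y → r *ₗ x ≈ᴹ (r * s) *ₗ y
    multiple r {s} {x} {y} x≈sy =
      ≈ᴹ-trans (*ₗ-cong refl x≈sy) (≈ᴹ-sym (*ₗ-assoc r s y))

  -- The diagonal entries yield the relations; entries next to the diagonal serve to prove
  -- independence.
  combination-entry : ∀ X e → X ≈ₑ linComb F (EndSpace F V) e generators →
    ∀ i j → matrix β X j i ≈ (e 0F + e 1F * θ i) * coord F V β (v i) j
                             + (e 2F + e 3F * θ i) * matrix β A j i
  combination-entry X e X≈ i j =
    trans (coord-cong j (combination-eigenvector X e X≈ i))
      (coord-combination j _ _ (v i) (⟦ A ⟧ (v i)))

  combination-diagonal : ∀ X e → X ≈ₑ linComb F (EndSpace F V) e generators →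
    ∀ i → matrix β X i i ≈ (e 0F + e 1F * θ i) + (e 2F + e 3F * θ i) * a i
  combination-diagonal X e X≈ i = trans (combination-entry X e X≈ i i)
    (+-congʳ (trans (*-congˡ (coord-diagonal i)) (*-identityʳ _)))

  zero-diagonal⇒relation : ∀ {X} (X∈Z : ZeroDiagonalSpace Φ X) →
                           Relation (proj₁ (proj₁ X∈Z))
  zero-diagonal⇒relation {X} ((e , X≈) , EXE≈0) i =
    trans (sym (combination-diagonal X e X≈ i))
      (zero-diagonal⇒entry≈0 X i (EXE≈0 i))

  relation⇒zero-diagonal : ∀ X e → X ≈ₑ linComb F (EndSpace F V) e generators →
                           Relation e → ZeroDiagonalSpace Φ X
  relation⇒zero-diagonal X e X≈ rel = (e , X≈) , λ i →
    entry≈0⇒zero-diagonal X i (trans (combination-diagonal X e X≈ i) (rel i))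

  a-constant : HasDimension F (EndSpace F V) (ZeroDiagonalSpace Φ) 2 →
               ∀ i j → a i ≈ a j
  a-constant (X , isBasis) = constant e f
    (zero-diagonal⇒relation {X 0F} (belongs 0F))
    (zero-diagonal⇒relation {X 1F} (belongs 1F))
    λ r s re+sf≈0 →
      let r∷s = r ∷ s ∷ []
          r∷s≈0 = independent r∷s λ x → ≈ᴹ-trans
            (W.linComb₂ generators {X} e f (proj₂ (proj₁ (belongs 0F)))
              (proj₂ (proj₁ (belongs 1F))) r∷s x)
            (W.linComb-zero generators (λ l → r * e l + s * f l) re+sf≈0 x)
      in r∷s≈0 0F , r∷s≈0 1F
    where
    open IsBasisOf isBasis
    e = proj₁ (proj₁ (belongs 0F))
    f = proj₁ (proj₁ (belongs 1F))

  -- By `E*-projection`, `E* i ∘ₑ A` has rank one: it sends `x` to the `i`-th coordinate of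
  -- `⟦ A ⟧ x` times `v i`.
  trace-E*A : (b : Basis F V (suc (suc (suc d)))) → ∀ i →
              trace b (E* i ∘ₑ A) ≈ a i
  trace-E*A b i = Coordinates.trace-rank-one b (E* i ∘ₑ A) (v i)
    (λ x → coord F V β (⟦ A ⟧ x) i)
    (coord-cong i ∘ End.⟦⟧-cong A)
    (λ x y → trans (coord-cong i (End.+ᴹ-homo A x y)) (coord-+ i _ _))
    (λ r x → trans (coord-cong i (End.*ₗ-homo A r x)) (coord-*ₗ i r _))
    (λ x → E*-projection i (⟦ A ⟧ x))

  -- The basis of the zero diagonal space when the diagonal of `A` is constant.

  module ConstantDiagonal (a₀ : Carrier) (a≈a₀ : ∀ i → a i ≈ a₀) where

    basis : Vector (End F V) 2
    basis = A -ₑ a₀ ·ₑ idₑ ∷ A ∘ₑ A* -ₑ a₀ ·ₑ A* ∷ []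

    -- Converts coefficients over `basis` into coefficients over `generators`.
    coefficients : Vector Carrier 2 → Vector Carrier 4
    coefficients r = - a₀ * r 0F ∷ - a₀ * r 1F ∷ r 0F ∷ r 1F ∷ []

    linComb-basis : ∀ r → linComb F (EndSpace F V) r basis
                          ≈ₑ linComb F (EndSpace F V) (coefficients r) generators
    linComb-basis r x = begin
      r 0F *ₗ (⟦ A ⟧ x +ᴹ -ᴹ (a₀ *ₗ x)) +ᴹ
        (r 1F *ₗ (⟦ A ⟧ (⟦ A* ⟧ x) +ᴹ -ᴹ (a₀ *ₗ ⟦ A* ⟧ x)) +ᴹ 0ᴹ)
        ≈⟨ +ᴹ-cong (expand (r 0F) x (⟦ A ⟧ x))
             (+ᴹ-cong (expand (r 1F) (⟦ A* ⟧ x) (⟦ A ⟧ (⟦ A* ⟧ x))) ≈ᴹ-refl) ⟩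
      ((- a₀ * r 0F) *ₗ x +ᴹ r 0F *ₗ ⟦ A ⟧ x) +ᴹ
        (((- a₀ * r 1F) *ₗ ⟦ A* ⟧ x +ᴹ r 1F *ₗ ⟦ A ⟧ (⟦ A* ⟧ x)) +ᴹ 0ᴹ)
        ≈⟨ solve 4 (λ x y z w →
             (x ⊕ y) ⊕ ((z ⊕ w) ⊕ id) ⊜ x ⊕ (z ⊕ (y ⊕ (w ⊕ id)))) ≈ᴹ-refl _ _ _ _ ⟩
      (- a₀ * r 0F) *ₗ x +ᴹ ((- a₀ * r 1F) *ₗ ⟦ A* ⟧ x +ᴹ
        (r 0F *ₗ ⟦ A ⟧ x +ᴹ (r 1F *ₗ ⟦ A ⟧ (⟦ A* ⟧ x) +ᴹ 0ᴹ))) ∎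
      where
      open SetoidReasoning ≈ᴹ-setoid
      open CommutativeMonoidSolver +ᴹ-commutativeMonoid using (solve; _⊕_; _⊜_; id)
      open GroupProperties +ᴹ-group using () renaming (inverseˡ-unique to -ᴹ-unique)
      expand : ∀ s y z → s *ₗ (z +ᴹ -ᴹ (a₀ *ₗ y)) ≈ᴹ (- a₀ * s) *ₗ y +ᴹ s *ₗ z
      expand s y z = begin
        s *ₗ (z +ᴹ -ᴹ (a₀ *ₗ y))
          ≈⟨ *ₗ-cong refl (+ᴹ-cong ≈ᴹ-refl (-ᴹ-unique (- a₀ *ₗ y) (a₀ *ₗ y)
               (≈ᴹ-trans (≈ᴹ-sym (*ₗ-distribʳ y (- a₀) a₀))
                 (0*ₗx≈0 y (-‿inverseˡ a₀))))) ⟨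
        s *ₗ (z +ᴹ - a₀ *ₗ y)
          ≈⟨ *ₗ-distribˡ s z (- a₀ *ₗ y) ⟩
        s *ₗ z +ᴹ s *ₗ - a₀ *ₗ y
          ≈⟨ +ᴹ-comm _ _ ⟩
        s *ₗ - a₀ *ₗ y +ᴹ s *ₗ z
          ≈⟨ +ᴹ-cong (*ₗ-assoc s (- a₀) y) ≈ᴹ-refl ⟨
        (s * - a₀) *ₗ y +ᴹ s *ₗ z
          ≈⟨ +ᴹ-cong (*ₗ-cong (*-comm s (- a₀)) ≈ᴹ-refl) ≈ᴹ-refl ⟩
        (- a₀ * s) *ₗ y +ᴹ s *ₗ z ∎

    -- The left-hand side factors, with `- a₀ + a i` as a factor.
    relation-coefficients : ∀ r → Relation (coefficients r)
    relation-coefficients r i = trans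
      (solve 5 (λ n p q t u → (n :* p :+ n :* q :* t) :+ (p :+ q :* t) :* u
                              := (p :+ q :* t) :* (n :+ u))
        refl (- a₀) (r 0F) (r 1F) (θ i) (a i))
      (x*0≈0 _ (trans (+-congˡ (a≈a₀ i)) (-‿inverseˡ a₀)))
      where open SemiringSolver commutativeSemiring using (solve; _:+_; _:*_; _:=_)

    relation⇒coefficients : ∀ e → Relation e →
      ∀ l → e l ≈ coefficients (e 2F ∷ e 3F ∷ []) l
    relation⇒coefficients e rel = λ
      { 0F → trans (inverseˡ-unique _ _ (proj₁ vanish)) (-‿distribˡ-* a₀ (e 2F))
      ; 1F → trans (inverseˡ-unique _ _ (proj₂ vanish)) (-‿distribˡ-* a₀ (e 3F))
      ; 2F → refl
      ; 3F → refl }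
      where
      open SemiringSolver commutativeSemiring using (solve; _:+_; _:*_; _:=_)
      root : ∀ i → (e 0F + a₀ * e 2F) + (e 1F + a₀ * e 3F) * θ i ≈ 0#
      root i = trans
        (solve 6 (λ e₀ e₁ e₂ e₃ t u →
            (e₀ :+ u :* e₂) :+ (e₁ :+ u :* e₃) :* t
            := (e₀ :+ e₁ :* t) :+ (e₂ :+ e₃ :* t) :* u)
          refl (e 0F) (e 1F) (e 2F) (e 3F) (θ i) a₀)
        (trans (+-congˡ (*-congˡ (sym (a≈a₀ i)))) (rel i))
      vanish = linear-zero θ₀≉θ₁ (root 0F) (root 1F)

    -- In a vanishing combination, an entry next to the diagonal is `r 0F + r 1F * θ i` times a
    -- nonzero entry of `A`. Columns 0 and 1 give two distinct roots.
    independent : LinearlyIndependent F (EndSpace F V) basis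
    independent r r∙basis≈0 = λ { 0F → proj₁ r≈0 ; 1F → proj₂ r≈0 }
      where
      off-diagonal : ∀ i j → j ≢ i → ∣ toℕ j - toℕ i ∣ ≡ 1 → r 0F + r 1F * θ i ≈ 0#
      off-diagonal i j j≢i ∣j-i∣≡1 = nonzero-cancelˡ
        (IrreducibleTridiagonal.irreducible {F = F} {V} (proj₁ E*.standard) j i ∣j-i∣≡1)
        (trans (*-comm _ _) (x+0≈0⇒x≈0
          (trans (+-comm _ _) (trans
            (sym (combination-entry 0ₑ (coefficients r)
              (λ x → ≈ᴹ-trans (≈ᴹ-sym (r∙basis≈0 x)) (linComb-basis r x)) i j))
            (coord-zero j)))
          (x*0≈0 _ (coord-off-diagonal i j j≢i))))
      r≈0 = linear-zero θ₀≉θ₁ (off-diagonal 0F 1F (λ ()) ≡.refl)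
                            (off-diagonal 1F 0F (λ ()) ≡.refl)

    isBasis : IsBasisOf F (EndSpace F V) (ZeroDiagonalSpace Φ) basis
    isBasis = record
      -- Each `basis i` is the combination of `basis` with coefficients `indicator F i`.
      { belongs = λ i → relation⇒zero-diagonal (basis i)
          (coefficients (indicator F i))
          (λ x → ≈ᴹ-trans (≈ᴹ-sym (W.linComb-indicator basis i x))
                          (linComb-basis (indicator F i) x))
          (relation-coefficients (indicator F i))
      ; independent = independent
      -- The coefficients over `basis` are those of `A` and `A ∘ₑ A*`; the relations fix the other
      -- two.
      ; spans = λ { X X∈Z@((e , X≈) , _) → (e 2F ∷ e 3F ∷ []) , λ x →
          ≈ᴹ-trans (X≈ x) (≈ᴹ-trans
            (W.linComb-cong generators {e} {coefficients (e 2F ∷ e 3F ∷ [])}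
              (relation⇒coefficients e (zero-diagonal⇒relation {X} X∈Z)) x)
            (≈ᴹ-sym (linComb-basis (e 2F ∷ e 3F ∷ []) x))) }
      }

lemma5p10 : {c ℓ m ℓm : Level}
    (F : Field c ℓ) → AlgebraicallyClosed F →
    (V : VectorSpace F m ℓm) (d : ℕ) → 3 ≤ d →
    (basisV : Basis F V (suc d)) →
    (Φ : LeonardSystem F V d) →
    HasDimension F (EndSpace F V) (ZeroDiagonalSpace Φ) 2 →
    let open LeonardSystem Φ
        a₀ = trace basisV (E* zero ∘ₑ A)
    in IsBasisOf F (EndSpace F V) (ZeroDiagonalSpace Φ)
         (A -ₑ a₀ ·ₑ idₑ ∷ A ∘ₑ A* -ₑ a₀ ·ₑ A* ∷ [])
-- Matching on the bound exhibits the three eigenvalues of `A*` on which the quadratic of the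
-- elimination vanishes.
lemma5p10 F _ V (suc (suc d)) (s≤s (s≤s _)) basisV Φ dim-Z≡2 =
  ConstantDiagonal.isBasis (trace basisV (E* zero ∘ₑ A)) λ i →
    trans (a-constant dim-Z≡2 i zero) (sym (trace-E*A basisV zero))
  where
  open Field F using (trans; sym)
  open LeonardSystem Φ
  open LeonardSystemLemmas F V Φ
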